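{- Let $\mathcal{R}$ be a right-stable deterministic conditional term rewrite system (DCTRS) such that the unraveled TRS $\mathbb{U}_{seq}(\mathcal{R})$ is confluent and terminating. Then $\mathcal{R}$ is confluent (i.e. whenever $s \rightarrow^*_{\mathcal{R}} t_1$ and $s \rightarrow^*_{\mathcal{R}} t_2$ there is $w$ with $t_1 \rightarrow^*_{\mathcal{R}} w$ and $t_2 \rightarrow^*_{\mathcal{R}} w$).
   Context: Terms $\mathcal{T}=\mathcal{T}(\mathcal{F},\mathcal{V})$ over a signature $\mathcal{F}$ and a countably infinite set of variables $\mathcal{V}$. An (oriented) conditional rule has the form $l \rightarrow r \Leftarrow s_1 \rightarrow^* t_1, \ldots, s_k \rightarrow^* t_k$ ($k\ge 0$, $k=0$ meaning an unconditional rule). It is deterministic if $\mathcal{V}ar(r) \subseteq \mathcal{V}ar(l) \cup \mathcal{V}ar(s_1,t_1,\ldots,s_k,t_k)$ and $\mathcal{V}ar(s_i) \subseteq \mathcal{V}ar(l, t_1, \ldots, t_{i-1})$ for all $i$. A DCTRS $\mathcal{R}$ is a set of deterministic conditional rules; its underlying TRS is $\mathcal{R}_u=\{l\rightarrow r \mid l \rightarrow r \Leftarrow c \in \mathcal{R}\}$. The rewrite relation of $\mathcal{R}$: $\mathcal{R}_0=\emptyset$, $\mathcal{R}_{n+1}=\{l\sigma \rightarrow r\sigma \mid l \rightarrow r \Leftarrow s_1 \rightarrow^* t_1,\ldots,s_k\rightarrow^* t_k \in \mathcal{R},\ s_j\sigma \rightarrow^*_{\mathcal{R}_n} t_j\sigma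 \text{ for all } j\}$, and $u \rightarrow_{\mathcal{R}} v$ iff $u \rightarrow_{\mathcal{R}_n} v$ for some $n$ (ordinary rewriting with the unconditional rules of $\mathcal{R}_n$). $\mathcal{R}$ is right-stable if for every rule and every $i$, $t_i$ is either a linear constructor term (containing no root symbol of a left-hand side of $\mathcal{R}$) or a ground term irreducible w.r.t. $\mathcal{R}_u$, and $\mathcal{V}ar(t_i) \cap \mathcal{V}ar(l, s_1, t_1, \ldots, s_{i-1}, t_{i-1}, s_i) = \emptyset$. Sequential unraveling: for a conditional rule $\alpha: l \rightarrow r \Leftarrow s_1 \rightarrow^* t_1, \ldots, s_k \rightarrow^* t_k$ with $k\ge1$, let $X_i=\mathcal{V}ar(l,t_1,\ldots,t_{i-1})$ and $\vec{X_i}$ a fixed ordering of $X_i$; introduce fresh function symbols $U^\alpha_1,\ldots,U^\alpha_k$ and set $\mathbb{U}_{seq}(\alpha)=\{l \rightarrow U^\alpha_1(s_1,\vec{X_1})\}\cup\{U^\alpha_i(t_i,\vec{X_i}) \rightarrow U^\alpha_{i+1}(s_{i+1},\vec{X_{i+1}}) \mid 1\le i<k\}\cup\{U^\alpha_k(t_k,\vec{X_k}) \rightarrow r\}$; for an unconditional rule $\alpha$, $\mathbb{U}_{seq}(\alpha)=\{\alpha\}$. $\mathbb{U}_{seq}(\mathcal{R})=\bigcup_{\alpha\in\mathcal{R}}\mathbb{U}_{seq}(\alpha)$, an unconditional TRS over the extended signature. -}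

module Defs where

open import Data.Nat using (ℕ; zero; suc; _≟_)
open import Data.Fin using (Fin; toℕ)
open import Data.Vec using (Vec; []; _∷_; lookup; _[_]≔_; fromList)
import Data.Vec as Vec
open import Data.List using (List; []; _∷_; _++_; length; take; deduplicate; concatMap)
import Data.List as List
open import Data.List.Membership.Propositional using (_∈_)
open import Data.List.Relation.Unary.All using (All)
open import Data.List.Relation.Unary.Unique.Propositional using (Unique)
open import Data.Product using (Σ; ∃; _×_; _,_; proj₁; proj₂)
open import Data.Sum using (_⊎_; inj₁; inj₂)
open import Data.Empty using (⊥)
open import Relation.Nullary using (¬_)
open import Relation.Binary.PropositionalEquality using (_≡_)
open import Relation.Binary.Construct.Closure.ReflexiveTransitive using (Star)
open import Induction.WellFounded using (WellFounded)
open import Function using (flip)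

data Term (F : Set) (ar : F → ℕ) : Set where
  var : ℕ → Term F ar
  fun : (f : F) → Vec (Term F ar) (ar f) → Term F ar

module _ {F : Set} {ar : F → ℕ} where

  Subst : Set
  Subst = ℕ → Term F ar

  mutual
    _⟨_⟩ : Term F ar → Subst → Term F ar
    var x ⟨ σ ⟩ = σ x
    fun f ts ⟨ σ ⟩ = fun f (substs ts σ)

    substs : ∀ {n} → Vec (Term F ar) n → Subst → Vec (Term F ar) n
    substs [] σ = []
    substs (t ∷ ts) σ = (t ⟨ σ ⟩) ∷ substs ts σ

  mutual
    vars : Term F ar → List ℕ
    vars (var x) = x ∷ []
    vars (fun f ts) = varsV ts

    varsV : ∀ {n} → Vec (Term F ar) n → List ℕ
    varsV [] = []
    varsV (t ∷ ts) = vars t ++ varsV ts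

  mutual
    data _occursIn_ (g : F) : Term F ar → Set where
      here  : ∀ ts → g occursIn fun g ts
      below : ∀ {f ts} → g occursInV ts → g occursIn fun f ts

    data _occursInV_ (g : F) : ∀ {n} → Vec (Term F ar) n → Set where
      here  : ∀ {n t} {ts : Vec (Term F ar) n} → g occursIn t → g occursInV (t ∷ ts)
      there : ∀ {n t} {ts : Vec (Term F ar) n} → g occursInV ts → g occursInV (t ∷ ts)

  RuleSet : Set₁
  RuleSet = Term F ar → Term F ar → Set

  data Step (Rl : RuleSet) : Term F ar → Term F ar → Set where
    root : ∀ {l r} (σ : Subst) → Rl l r → Step Rl (l ⟨ σ ⟩) (r ⟨ σ ⟩)
    arg  : ∀ {f} {ts : Vec (Term F ar) (ar f)} (i : Fin (ar f)) {u} →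
           Step Rl (lookup ts i) u → Step Rl (fun f ts) (fun f (ts [ i ]≔ u))

  Steps : RuleSet → Term F ar → Term F ar → Set
  Steps Rl = Star (Step Rl)

  Confluent : (Term F ar → Term F ar → Set) → Set
  Confluent _⇒_ = ∀ {s t₁ t₂} → Star _⇒_ s t₁ → Star _⇒_ s t₂ →
                  ∃ λ w → Star _⇒_ t₁ w × Star _⇒_ t₂ w

  Terminating : (Term F ar → Term F ar → Set) → Set
  Terminating _⇒_ = WellFounded (flip _⇒_)

  NormalForm : RuleSet → Term F ar → Set
  NormalForm Rl t = ∀ u → ¬ Step Rl t u

-- Conditional rules  l → r ⇐ s₁ →* t₁, …, s_k →* t_k

record CRule (F : Set) (ar : F → ℕ) : Set where
  constructor _⇒_⇐_
  field
    lhs   : Term F ar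
    rhs   : Term F ar
    conds : List (Term F ar × Term F ar)
open CRule public

module _ {F : Set} {ar : F → ℕ} {I : Set} (R : I → CRule F ar) where

  varsT : List (Term F ar × Term F ar) → List ℕ
  varsT cs = concatMap (λ c → vars (proj₂ c)) cs

  varsST : List (Term F ar × Term F ar) → List ℕ
  varsST cs = concatMap (λ c → vars (proj₁ c) ++ vars (proj₂ c)) cs

  _⊆ᵥ_ : List ℕ → List ℕ → Set
  xs ⊆ᵥ ys = ∀ {x} → x ∈ xs → x ∈ ys

  DeterministicRule : CRule F ar → Set
  DeterministicRule ρ =
    (vars (rhs ρ) ⊆ᵥ (vars (lhs ρ) ++ varsST (conds ρ))) ×
    (∀ (i : Fin (length (conds ρ))) →
       vars (proj₁ (List.lookup (conds ρ) i))
         ⊆ᵥ (vars (lhs ρ) ++ varsT (take (toℕ i) (conds ρ))))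

  DCTRS : Set
  DCTRS = ∀ α → DeterministicRule (R α)

  Ru : RuleSet
  Ru l r = Σ I λ α → (lhs (R α) ≡ l) × (rhs (R α) ≡ r)

  Defined : F → Set
  Defined f = Σ I λ α → Σ (Vec (Term F ar) (ar f)) λ ts → lhs (R α) ≡ fun f ts

  LinearConstructorTerm : Term F ar → Set
  LinearConstructorTerm t = Unique (vars t) × (∀ f → f occursIn t → ¬ Defined f)

  Ground : Term F ar → Set
  Ground t = vars t ≡ []

  Disjoint : List ℕ → List ℕ → Set
  Disjoint xs ys = ∀ {x} → x ∈ xs → x ∈ ys → ⊥

  RightStableRule : CRule F ar → Set
  RightStableRule ρ =
    ∀ (i : Fin (length (conds ρ))) →
      let tᵢ = proj₂ (List.lookup (conds ρ) i)
          sᵢ = proj₁ (List.lookup (conds ρ) i) in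
      (LinearConstructorTerm tᵢ ⊎ (Ground tᵢ × NormalForm Ru tᵢ)) ×
      Disjoint (vars tᵢ)
               (vars (lhs ρ) ++ varsST (take (toℕ i) (conds ρ)) ++ vars sᵢ)

  RightStable : Set
  RightStable = ∀ α → RightStableRule (R α)

  mutual
    Level : ℕ → RuleSet
    Level zero l r = ⊥
    Level (suc n) l r =
      Σ I λ α → Σ Subst λ σ →
        (lhs (R α) ⟨ σ ⟩ ≡ l) × (rhs (R α) ⟨ σ ⟩ ≡ r) ×
        All (λ c → Steps (Level n) (proj₁ c ⟨ σ ⟩) (proj₂ c ⟨ σ ⟩)) (conds (R α))

  _→R_ : Term F ar → Term F ar → Set
  u →R v = Σ ℕ λ n → Step (Level n) u v

  USym : Set
  USym = Σ I λ α → Fin (length (conds (R α)))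

  -- X_j : fixed ordering (left-to-right first occurrence) of Var(l, t_1, …, t_{j})
  -- for 0-indexed j (i.e. X_{j+1} in the paper's 1-indexed notation)
  Xs : (α : I) → Fin (length (conds (R α))) → List ℕ
  Xs α j = deduplicate _≟_ (vars (lhs (R α)) ++ varsT (take (toℕ j) (conds (R α))))

  Fᵤ : Set
  Fᵤ = F ⊎ USym

  arᵤ : Fᵤ → ℕ
  arᵤ (inj₁ f) = ar f
  arᵤ (inj₂ (α , j)) = suc (length (Xs α j))

  Termᵤ : Set
  Termᵤ = Term Fᵤ arᵤ

  mutual
    emb : Term F ar → Termᵤ
    emb (var x) = var x
    emb (fun f ts) = fun (inj₁ f) (embV ts)

    embV : ∀ {n} → Vec (Term F ar) n → Vec Termᵤ n
    embV [] = []
    embV (t ∷ ts) = emb t ∷ embV ts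

  Uterm : (α : I) (j : Fin (length (conds (R α)))) → Termᵤ → Termᵤ
  Uterm α j u = fun (inj₂ (α , j)) (u ∷ Vec.map var (fromList (Xs α j)))

  sᵤ tᵤ : (α : I) → Fin (length (conds (R α))) → Termᵤ
  sᵤ α j = emb (proj₁ (List.lookup (conds (R α)) j))
  tᵤ α j = emb (proj₂ (List.lookup (conds (R α)) j))

  data Useq : Termᵤ → Termᵤ → Set where
    uncond : ∀ α → conds (R α) ≡ [] → Useq (emb (lhs (R α))) (emb (rhs (R α)))
    start  : ∀ α (j : Fin (length (conds (R α)))) → toℕ j ≡ 0 →
             Useq (emb (lhs (R α))) (Uterm α j (sᵤ α j))
    middle : ∀ α (j j' : Fin (length (conds (R α)))) → suc (toℕ j) ≡ toℕ j' →
             Useq (Uterm α j (tᵤ α j)) (Uterm α j' (sᵤ α j'))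
    finish : ∀ α (j : Fin (length (conds (R α)))) → suc (toℕ j) ≡ length (conds (R α)) →
             Useq (Uterm α j (tᵤ α j)) (emb (rhs (R α)))

{-# OPTIONS --safe #-}

-- Since reducibility is undecidable, normal forms are not available.  A term of the unraveling is
-- decoded by replacing every pending U_j(b, σ) by lσ, and it is "good" if inside every such subterm
-- s_jσ and b, as well as s_iσ and t_iσ for i < j, are joinable in the unraveling; by confluence this
-- survives rewriting.  A reduction u →* v of a good term can be extended to u →* v →* v' with
-- decode u →* decode v' in R.  Only the closing step U_k(t_kσ, σ) → rσ matters: joinability is turned
-- into R-derivations s_iσ' →* t_iσ' one condition at a time, by well-founded induction, because the
-- terms s_iσ' lie below lσ in the union of rewriting and the subterm relation.
module Submission where

open import Defs
open import Data.Nat using (ℕ; zero; suc; _≤_; _<_; s≤s; z≤n; _≟_; _⊔_; _≤′_; ≤′-refl; ≤′-step)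
open import Data.Nat.Properties using
  (≤-trans; ≤-refl; ≤-reflexive; <⇒≤; m≤m⊔n; m≤n⊔m; m<1+n⇒m<n∨m≡n; ≤⇒≤′; n≮0)
open import Data.Fin using (Fin; zero; suc; toℕ; fromℕ<)
open import Data.Fin.Properties using (toℕ<n; toℕ-fromℕ<; toℕ-injective)
open import Data.Vec using (Vec; []; _∷_; lookup; _[_]≔_; fromList)
import Data.Vec as Vec
open import Data.Vec.Properties using ([]≔-lookup; []≔-idempotent; lookup∘update)
open import Data.Vec.Relation.Binary.Pointwise.Inductive using (Pointwise; []; _∷_)
open import Data.List using (List; []; _∷_; _++_; length; take)
import Data.List as List
open import Data.List.Properties using (++-conicalˡ; ++-conicalʳ)
open import Data.List.Membership.Propositional using (_∈_; _∉_)
open import Data.List.Membership.Propositional.Properties using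
  (∈-++⁺ˡ; ∈-++⁺ʳ; ∈-++⁻; ∈-lookup; ∈-deduplicate⁺; ∈-deduplicate⁻)
open import Data.List.Membership.DecPropositional _≟_ using (_∈?_)
open import Data.List.Relation.Unary.Any using (here; there)
open import Data.List.Relation.Unary.All using (All; []; _∷_)
import Data.List.Relation.Unary.All as All
open import Data.List.Relation.Unary.AllPairs using ([]; _∷_)
open import Data.List.Relation.Unary.Unique.Propositional using (Unique)
open import Data.List.Relation.Unary.Unique.DecPropositional.Properties _≟_ using (deduplicate-!)
open import Data.Product using (Σ; ∃; _×_; _,_; proj₁; proj₂)
open import Data.Sum using (_⊎_; inj₁; inj₂)
open import Data.Empty using (⊥; ⊥-elim)
open import Data.Unit using (⊤; tt)
open import Function using (flip; _∘_)
open import Induction.WellFounded using (WellFounded; Acc; acc)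
open import Relation.Nullary using (¬_; yes; no)
open import Relation.Binary.PropositionalEquality using
  (_≡_; _≢_; refl; sym; trans; cong; cong₂; subst; subst₂)
open import Relation.Binary.Construct.Closure.ReflexiveTransitive using
  (Star; ε; _◅_; _◅◅_; gmap; return)

-- Reduction sequences and lists

Joinable : {A : Set} → (A → A → Set) → A → A → Set
Joinable _⇒_ a b = ∃ λ c → Star _⇒_ a c × Star _⇒_ b c

≡⇒Star : {A : Set} {P : A → A → Set} {a b : A} → a ≡ b → Star P a b
≡⇒Star refl = ε

-- Accessibility is consumed at the front of a sequence, while the step known to be strict often
-- stands at its end.
Star-snoc⇒cons : {A : Set} {P : A → A → Set} {a b c : A} → Star P a b → P b c →
                 ∃ λ d → P a d × Star P d c
Star-snoc⇒cons ε q = _ , q , ε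
Star-snoc⇒cons (p ◅ ps) q = _ , p , ps ◅◅ return q

Unique-++ˡ : ∀ (xs : List ℕ) {ys} → Unique (xs ++ ys) → Unique xs
Unique-++ˡ [] _ = []
Unique-++ˡ (x ∷ xs) (p ∷ u) = All.tabulate (λ q → All.lookup p (∈-++⁺ˡ q)) ∷ Unique-++ˡ xs u

Unique-++ʳ : ∀ (xs : List ℕ) {ys} → Unique (xs ++ ys) → Unique ys
Unique-++ʳ [] u = u
Unique-++ʳ (x ∷ xs) (p ∷ u) = Unique-++ʳ xs u

Unique-++-disjoint : ∀ (xs : List ℕ) {ys x} → Unique (xs ++ ys) → x ∈ xs → x ∉ ys
Unique-++-disjoint (x ∷ xs) (p ∷ u) (here refl) q = All.lookup p (∈-++⁺ʳ xs q) refl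
Unique-++-disjoint (x ∷ xs) (p ∷ u) (there r) q = Unique-++-disjoint xs u r q

All-fin : {A : Set} {P : A → Set} (xs : List A) → (∀ i → P (List.lookup xs i)) → All P xs
All-fin [] h = []
All-fin (x ∷ xs) h = h zero ∷ All-fin xs (h ∘ suc)

lookup-All : {A : Set} {P : A → Set} {xs : List A} → All P xs → ∀ i → P (List.lookup xs i)
lookup-All {xs = xs} ps i = All.lookup ps (∈-lookup i)

[]-or-first : {A : Set} (xs : List A) → xs ≡ [] ⊎ Σ (Fin (length xs)) λ j → toℕ j ≡ 0
[]-or-first [] = inj₁ refl
[]-or-first (x ∷ xs) = inj₂ (zero , refl)

[]-or-last : {A : Set} (xs : List A) →
             xs ≡ [] ⊎ Σ (Fin (length xs)) λ j → suc (toℕ j) ≡ length xs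
[]-or-last [] = inj₁ refl
[]-or-last (x ∷ xs) with []-or-last xs
... | inj₁ refl = inj₂ (zero , refl)
... | inj₂ (j , e) = inj₂ (suc j , cong suc e)

-- Terms and substitutions

module _ {F : Set} {ar : F → ℕ} where

  private
    T : Set
    T = Term F ar

  lookup-substs : ∀ {n} (ts : Vec T n) σ i → lookup (substs ts σ) i ≡ lookup ts i ⟨ σ ⟩
  lookup-substs (t ∷ ts) σ zero = refl
  lookup-substs (t ∷ ts) σ (suc i) = lookup-substs ts σ i

  substs-update : ∀ {n} (ts : Vec T n) σ i u →
                  substs (ts [ i ]≔ u) σ ≡ substs ts σ [ i ]≔ (u ⟨ σ ⟩)
  substs-update (t ∷ ts) σ zero u = refl
  substs-update (t ∷ ts) σ (suc i) u = cong (_ ∷_) (substs-update ts σ i u)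

  mutual
    subst-cong : ∀ (t : T) {σ τ} → (∀ {x} → x ∈ vars t → σ x ≡ τ x) → t ⟨ σ ⟩ ≡ t ⟨ τ ⟩
    subst-cong (var x) h = h (here refl)
    subst-cong (fun f ts) h = cong (fun f) (substs-cong ts h)

    substs-cong : ∀ {n} (ts : Vec T n) {σ τ} →
                  (∀ {x} → x ∈ varsV ts → σ x ≡ τ x) → substs ts σ ≡ substs ts τ
    substs-cong [] h = refl
    substs-cong (t ∷ ts) h =
      cong₂ _∷_ (subst-cong t (h ∘ ∈-++⁺ˡ)) (substs-cong ts (h ∘ ∈-++⁺ʳ (vars t)))

  mutual
    subst-∘ : ∀ (t : T) σ τ → t ⟨ σ ⟩ ⟨ τ ⟩ ≡ t ⟨ (λ x → σ x ⟨ τ ⟩) ⟩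
    subst-∘ (var x) σ τ = refl
    subst-∘ (fun f ts) σ τ = cong (fun f) (substs-∘ ts σ τ)

    substs-∘ : ∀ {n} (ts : Vec T n) σ τ →
               substs (substs ts σ) τ ≡ substs ts (λ x → σ x ⟨ τ ⟩)
    substs-∘ [] σ τ = refl
    substs-∘ (t ∷ ts) σ τ = cong₂ _∷_ (subst-∘ t σ τ) (substs-∘ ts σ τ)

  mutual
    subst-id : ∀ (t : T) → t ⟨ var ⟩ ≡ t
    subst-id (var x) = refl
    subst-id (fun f ts) = cong (fun f) (substs-id ts)

    substs-id : ∀ {n} (ts : Vec T n) → substs ts var ≡ ts
    substs-id [] = refl
    substs-id (t ∷ ts) = cong₂ _∷_ (subst-id t) (substs-id ts)

  ground-subst : ∀ (t : T) {σ} → vars t ≡ [] → t ⟨ σ ⟩ ≡ t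
  ground-subst t g = trans (subst-cong t λ {x} p → ⊥-elim (∉[] (subst (x ∈_) g p))) (subst-id t)
    where
    ∉[] : ∀ {x} → x ∉ []
    ∉[] ()

  step-subst : ∀ {Rl : RuleSet} {a b : T} τ → Step Rl a b → Step Rl (a ⟨ τ ⟩) (b ⟨ τ ⟩)
  step-subst {Rl} τ (root {l} {r} σ h) =
    subst₂ (Step Rl) (sym (subst-∘ l σ τ)) (sym (subst-∘ r σ τ)) (root _ h)
  step-subst {Rl} τ (arg {f} {ts} i {u} s) =
    subst (λ z → Step Rl _ (fun f z)) (sym (substs-update ts τ i u))
      (arg i (subst (λ z → Step Rl z _) (sym (lookup-substs ts τ i)) (step-subst τ s)))

  -- Closure of reductions under contexts and substitutions

  module _ (P : T → T → Set) where

    -- `C` is an arbitrary context on vectors rather than `fun f`, so that `star-args` can recurse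
    -- on the tail with the reduced head absorbed into the context.
    Monotone : ∀ {n} → (Vec T n → T) → Set
    Monotone C = ∀ ts i {u} → P (lookup ts i) u → P (C ts) (C (ts [ i ]≔ u))

    star-arg : ∀ {n} {C : Vec T n → T} → Monotone C → ∀ ts i {u} →
               Star P (lookup ts i) u → Star P (C ts) (C (ts [ i ]≔ u))
    star-arg {C = C} mono ts i ss = go ts ss refl
      where
      go : ∀ {a u} ts → Star P a u → lookup ts i ≡ a → Star P (C ts) (C (ts [ i ]≔ u))
      go ts ε refl = ≡⇒Star (cong C (sym ([]≔-lookup ts i)))
      go ts (_◅_ {j = b} s ss) refl =
        mono ts i s ◅ subst (λ z → Star P (C (ts [ i ]≔ b)) (C z)) ([]≔-idempotent ts i)
                     (go (ts [ i ]≔ b) ss (lookup∘update i ts b))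

    star-args : ∀ {n} {C : Vec T n → T} → Monotone C → ∀ {ts us} →
                Pointwise (Star P) ts us → Star P (C ts) (C us)
    star-args mono [] = ε
    star-args {C = C} mono {t ∷ ts} (p ∷ ps) =
      star-arg {C = C} mono (t ∷ ts) zero p ◅◅
      star-args {C = λ us → C (_ ∷ us)} (λ ts i → mono (_ ∷ ts) (suc i)) ps

    module _ (fun-mono : ∀ {f} → Monotone (fun f)) where
      mutual
        star-subst : ∀ (t : T) {σ τ} → (∀ {x} → x ∈ vars t → Star P (σ x) (τ x)) →
                     Star P (t ⟨ σ ⟩) (t ⟨ τ ⟩)
        star-subst (var x) h = h (here refl)
        star-subst (fun f ts) h = star-args fun-mono (stars-subst ts h)

        stars-subst : ∀ {n} (ts : Vec T n) {σ τ} → (∀ {x} → x ∈ varsV ts → Star P (σ x) (τ x)) →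
                      Pointwise (Star P) (substs ts σ) (substs ts τ)
        stars-subst [] h = []
        stars-subst (t ∷ ts) h =
          star-subst t (h ∘ ∈-++⁺ˡ) ∷ stars-subst ts (h ∘ ∈-++⁺ʳ (vars t))

  -- Updated substitutions and stored bindings

  updateAt-var : ℕ → T → (ℕ → T) → (ℕ → T)
  updateAt-var x u σ y with x ≟ y
  ... | yes _ = u
  ... | no  _ = σ y

  updateAt-var-≡ : ∀ x {u σ} → updateAt-var x u σ x ≡ u
  updateAt-var-≡ x with x ≟ x
  ... | yes _ = refl
  ... | no ¬e = ⊥-elim (¬e refl)

  updateAt-var-≢ : ∀ {x y u σ} → x ≢ y → updateAt-var x u σ y ≡ σ y
  updateAt-var-≢ {x} {y} ne with x ≟ y
  ... | yes e = ⊥-elim (ne e)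
  ... | no  _ = refl

  -- Reads the arguments stored under a U-symbol back as a substitution. The first occurrence wins,
  -- and a variable outside `xs` is left as it is.
  env : (xs : List ℕ) → Vec T (length xs) → ℕ → T
  env [] [] x = var x
  env (y ∷ ys) (t ∷ ts) x with x ≟ y
  ... | yes _ = t
  ... | no  _ = env ys ts x

  env-vars : ∀ xs σ {x} → x ∈ xs → env xs (substs (Vec.map var (fromList xs)) σ) x ≡ σ x
  env-vars (y ∷ ys) σ {x} p with x ≟ y
  env-vars (y ∷ ys) σ p           | yes refl = refl
  env-vars (y ∷ ys) σ (here e)    | no ¬e = ⊥-elim (¬e e)
  env-vars (y ∷ ys) σ (there p)   | no ¬e = env-vars ys σ p

  env-update-≢ : ∀ xs ts p {u x} → x ≢ List.lookup xs p → env xs (ts [ p ]≔ u) x ≡ env xs ts x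
  env-update-≢ (y ∷ ys) (t ∷ ts) zero {x = x} ne with x ≟ y
  ... | yes e = ⊥-elim (ne e)
  ... | no  _ = refl
  env-update-≢ (y ∷ ys) (t ∷ ts) (suc p) {x = x} ne with x ≟ y
  ... | yes _ = refl
  ... | no  _ = env-update-≢ ys ts p ne

  env-lookup : ∀ xs ts p → Unique xs → env xs ts (List.lookup xs p) ≡ lookup ts p
  env-lookup (y ∷ ys) (t ∷ ts) zero _ with y ≟ y
  ... | yes _ = refl
  ... | no ¬e = ⊥-elim (¬e refl)
  env-lookup (y ∷ ys) (t ∷ ts) (suc p) (q ∷ u) with List.lookup ys p ≟ y
  ... | yes e = ⊥-elim (All.lookup q (∈-lookup p) (sym e))
  ... | no  _ = env-lookup ys ts p u

  -- `Q` is abstract because it serves twice: for reduction in the unraveling and for reduction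
  -- between decodings. Reflexivity covers every variable that does not read position `p`.
  env-update-rel : (Q : T → T → Set) → (∀ {t} → Q t t) → ∀ xs ts p {u} → Q (lookup ts p) u →
                   ∀ x → Q (env xs ts x) (env xs (ts [ p ]≔ u) x)
  env-update-rel Q rfl (y ∷ ys) (t ∷ ts) zero q x with x ≟ y
  ... | yes _ = q
  ... | no  _ = rfl
  env-update-rel Q rfl (y ∷ ys) (t ∷ ts) (suc p) q x with x ≟ y
  ... | yes _ = rfl
  ... | no  _ = env-update-rel Q rfl ys ts p q x

  -- Termination modulo the subterm relation

  data _▷_ : T → T → Set where
    sub : ∀ {f ts} i → fun f ts ▷ lookup ts i

  mutual
    var-subterm : ∀ {P : T → T → Set} → (∀ {a b} → a ▷ b → P a b) →
                  ∀ (t : T) {σ x} → x ∈ vars t → Star P (t ⟨ σ ⟩) (σ x)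
    var-subterm inc (var x) (here refl) = ε
    var-subterm inc (fun f ts) {σ} p with var-subtermV inc ts {σ} p
    ... | i , ss = inc (sub i) ◅ ss

    var-subtermV : ∀ {P : T → T → Set} → (∀ {a b} → a ▷ b → P a b) →
                   ∀ {n} (ts : Vec T n) {σ x} → x ∈ varsV ts →
                   ∃ λ i → Star P (lookup (substs ts σ) i) (σ x)
    var-subtermV inc (t ∷ ts) p with ∈-++⁻ (vars t) p
    ... | inj₁ q = zero , var-subterm inc t q
    ... | inj₂ q with var-subtermV inc ts q
    ...   | i , ss = suc i , ss

  module _ {Rl : RuleSet {F} {ar}} where

    _≻_ : T → T → Set
    a ≻ b = Step Rl a b ⊎ a ▷ b

    -- A step inside an argument is also a step of the whole term, and the reduct is still an
    -- argument there: rewriting can be moved ahead of the subterm relation.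
    ▷-step-commute : ∀ {a b c} → a ▷ b → Step Rl b c → ∃ λ d → Step Rl a d × d ▷ c
    ▷-step-commute {c = c} (sub {f} {ts} i) s =
      fun f (ts [ i ]≔ c) , arg i s , subst (fun f (ts [ i ]≔ c) ▷_) (lookup∘update i ts c) (sub i)

    ▷⋆-step-commute : ∀ {a b c} → Star _▷_ a b → Step Rl b c → ∃ λ d → Step Rl a d × Star _▷_ d c
    ▷⋆-step-commute ε s = _ , s , ε
    ▷⋆-step-commute (p ◅ ps) s with ▷⋆-step-commute ps s
    ... | d , s′ , qs with ▷-step-commute p s′
    ...   | e , s″ , q = e , s″ , q ◅ qs

    -- Lexicographic induction: first an enclosing term `a` that is accessible for rewriting, then
    -- the structure of its subterm `b`. A step of `b` lifts to a step of `a`; descending to an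
    -- argument keeps `a` and shrinks `b`.
    ≻-wellFounded : Terminating (Step Rl) → WellFounded (flip _≻_)
    ≻-wellFounded term t = subterm-acc (term t) t ε
      where
      mutual
        subterm-acc : ∀ {a} → Acc (flip (Step Rl)) a → ∀ b → Star _▷_ a b → Acc (flip _≻_) b
        subterm-acc h b p = acc (successor-acc h b p)

        successor-acc : ∀ {a} → Acc (flip (Step Rl)) a → ∀ b → Star _▷_ a b →
                        ∀ {c} → b ≻ c → Acc (flip _≻_) c
        successor-acc (acc rs) b p (inj₁ s) with ▷⋆-step-commute p s
        ... | d , s′ , q = subterm-acc (rs s′) _ q
        successor-acc h (fun f ts) p (inj₂ (sub i)) =
          subterm-accV h ts (λ i → p ◅◅ return (sub i)) i

        -- Traverses the vector, because `lookup ts i` is not visibly a structurally smaller term.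
        subterm-accV : ∀ {a} → Acc (flip (Step Rl)) a → ∀ {n} (ts : Vec T n) →
                       (∀ i → Star _▷_ a (lookup ts i)) → ∀ i → Acc (flip _≻_) (lookup ts i)
        subterm-accV h (t ∷ ts) p zero = subterm-acc h t (p zero)
        subterm-accV h (t ∷ ts) p (suc i) = subterm-accV h ts (p ∘ suc) i

-- Unraveled terms and their decoding

module Unraveling {F : Set} {ar : F → ℕ} {I : Set} (R : I → CRule F ar) where

  T : Set
  T = Term F ar

  Tᵤ : Set
  Tᵤ = Termᵤ R

  ι : T → Tᵤ
  ι = emb R

  Index : I → Set
  Index α = Fin (length (conds (R α)))

  source target : (α : I) → Index α → T
  source α i = proj₁ (List.lookup (conds (R α)) i)
  target α i = proj₂ (List.lookup (conds (R α)) i)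

  lhsᵤ : I → Tᵤ
  lhsᵤ α = ι (lhs (R α))

  _↠_ : Tᵤ → Tᵤ → Set
  _↠_ = Steps (Useq R)

  _↠ᴿ_ : T → T → Set
  _↠ᴿ_ = Star (_→R_ R)

  mutual
    vars-emb : ∀ t → vars (ι t) ≡ vars t
    vars-emb (var x) = refl
    vars-emb (fun f ts) = varsV-embV ts

    varsV-embV : ∀ {n} (ts : Vec T n) → varsV (embV R ts) ≡ varsV ts
    varsV-embV [] = refl
    varsV-embV (t ∷ ts) = cong₂ _++_ (vars-emb t) (varsV-embV ts)

  ∈vars-emb⁻ : ∀ t {x} → x ∈ vars (ι t) → x ∈ vars t
  ∈vars-emb⁻ t = subst (_ ∈_) (vars-emb t)

  ∈vars-emb⁺ : ∀ t {x} → x ∈ vars t → x ∈ vars (ι t)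
  ∈vars-emb⁺ t = subst (_ ∈_) (sym (vars-emb t))

  emb-subst-cong : ∀ t {σ τ} → (∀ {x} → x ∈ vars t → σ x ≡ τ x) → ι t ⟨ σ ⟩ ≡ ι t ⟨ τ ⟩
  emb-subst-cong t h = subst-cong (ι t) (h ∘ ∈vars-emb⁻ t)

  mutual
    emb-subst : ∀ t σ → ι (t ⟨ σ ⟩) ≡ ι t ⟨ ι ∘ σ ⟩
    emb-subst (var x) σ = refl
    emb-subst (fun f ts) σ = cong (fun (inj₁ f)) (embV-substs ts σ)

    embV-substs : ∀ {n} (ts : Vec T n) σ → embV R (substs ts σ) ≡ substs (embV R ts) (ι ∘ σ)
    embV-substs [] σ = refl
    embV-substs (t ∷ ts) σ = cong₂ _∷_ (emb-subst t σ) (embV-substs ts σ)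

  lookup-embV : ∀ {n} (ts : Vec T n) i → lookup (embV R ts) i ≡ ι (lookup ts i)
  lookup-embV (t ∷ ts) zero = refl
  lookup-embV (t ∷ ts) (suc i) = lookup-embV ts i

  embV-update : ∀ {n} (ts : Vec T n) i u → embV R (ts [ i ]≔ u) ≡ embV R ts [ i ]≔ ι u
  embV-update (t ∷ ts) zero u = refl
  embV-update (t ∷ ts) (suc i) u = cong (_ ∷_) (embV-update ts i u)

  -- A pending term U_j(b, us) is decoded to the instance of the left-hand side it came from.
  mutual
    decode : Tᵤ → T
    decode (var x) = var x
    decode (fun (inj₁ f) us) = fun f (decodeV us)
    decode (fun (inj₂ (α , j)) (b ∷ us)) = lhs (R α) ⟨ env (Xs R α j) (decodeV us) ⟩

    decodeV : ∀ {n} → Vec Tᵤ n → Vec T n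
    decodeV [] = []
    decodeV (u ∷ us) = decode u ∷ decodeV us

  lookup-decodeV : ∀ {n} (us : Vec Tᵤ n) i → lookup (decodeV us) i ≡ decode (lookup us i)
  lookup-decodeV (u ∷ us) zero = refl
  lookup-decodeV (u ∷ us) (suc i) = lookup-decodeV us i

  decodeV-update : ∀ {n} (us : Vec Tᵤ n) i v → decodeV (us [ i ]≔ v) ≡ decodeV us [ i ]≔ decode v
  decodeV-update (u ∷ us) zero v = refl
  decodeV-update (u ∷ us) (suc i) v = cong (_ ∷_) (decodeV-update us i v)

  decode-env : ∀ xs us x → env xs (decodeV us) x ≡ decode (env xs us x)
  decode-env [] [] x = refl
  decode-env (y ∷ ys) (u ∷ us) x with x ≟ y
  ... | yes _ = refl
  ... | no  _ = decode-env ys us x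

  mutual
    decode-emb : ∀ t → decode (ι t) ≡ t
    decode-emb (var x) = refl
    decode-emb (fun f ts) = cong (fun f) (decodeV-embV ts)

    decodeV-embV : ∀ {n} (ts : Vec T n) → decodeV (embV R ts) ≡ ts
    decodeV-embV [] = refl
    decodeV-embV (t ∷ ts) = cong₂ _∷_ (decode-emb t) (decodeV-embV ts)

  mutual
    decode-emb-subst : ∀ t σ → decode (ι t ⟨ σ ⟩) ≡ t ⟨ decode ∘ σ ⟩
    decode-emb-subst (var x) σ = refl
    decode-emb-subst (fun f ts) σ = cong (fun f) (decodeV-embV-substs ts σ)

    decodeV-embV-substs : ∀ {n} (ts : Vec T n) σ →
                          decodeV (substs (embV R ts) σ) ≡ substs ts (decode ∘ σ)
    decodeV-embV-substs [] σ = refl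
    decodeV-embV-substs (t ∷ ts) σ = cong₂ _∷_ (decode-emb-subst t σ) (decodeV-embV-substs ts σ)

  decode-U : ∀ α j b us →
             decode (fun (inj₂ (α , j)) (b ∷ us)) ≡ lhs (R α) ⟨ decode ∘ env (Xs R α j) us ⟩
  decode-U α j b us = subst-cong (lhs (R α)) λ {x} _ → decode-env (Xs R α j) us x

  -- Variables of conditions

  varsT-take⁺ : ∀ cs (i : Fin (length cs)) {m x} → toℕ i < m →
                x ∈ vars (proj₂ (List.lookup cs i)) → x ∈ varsT R (take m cs)
  varsT-take⁺ (c ∷ cs) zero (s≤s _) p = ∈-++⁺ˡ p
  varsT-take⁺ (c ∷ cs) (suc i) (s≤s q) p = ∈-++⁺ʳ (vars (proj₂ c)) (varsT-take⁺ cs i q p)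

  varsT-take⁻ : ∀ cs m {x} → x ∈ varsT R (take m cs) →
                Σ (Fin (length cs)) λ i → toℕ i < m × x ∈ vars (proj₂ (List.lookup cs i))
  varsT-take⁻ [] zero ()
  varsT-take⁻ [] (suc m) ()
  varsT-take⁻ (c ∷ cs) (suc m) p with ∈-++⁻ (vars (proj₂ c)) p
  ... | inj₁ q = zero , s≤s z≤n , q
  ... | inj₂ q with varsT-take⁻ cs m q
  ...   | i , l , r = suc i , s≤s l , r

  varsST-take⁺ : ∀ cs (i : Fin (length cs)) {m x} → toℕ i < m →
                 x ∈ vars (proj₁ (List.lookup cs i)) ++ vars (proj₂ (List.lookup cs i)) →
                 x ∈ varsST R (take m cs)
  varsST-take⁺ (c ∷ cs) zero (s≤s _) p = ∈-++⁺ˡ p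
  varsST-take⁺ (c ∷ cs) (suc i) (s≤s q) p =
    ∈-++⁺ʳ (vars (proj₁ c) ++ vars (proj₂ c)) (varsST-take⁺ cs i q p)

  varsST⁻ : ∀ cs {x} → x ∈ varsST R cs →
            Σ (Fin (length cs)) λ i →
              x ∈ vars (proj₁ (List.lookup cs i)) ++ vars (proj₂ (List.lookup cs i))
  varsST⁻ (c ∷ cs) p with ∈-++⁻ (vars (proj₁ c) ++ vars (proj₂ c)) p
  ... | inj₁ q = zero , q
  ... | inj₂ q with varsST⁻ cs q
  ...   | i , r = suc i , r

  varsST⁺ : ∀ cs (i : Fin (length cs)) {x} →
            x ∈ vars (proj₁ (List.lookup cs i)) ++ vars (proj₂ (List.lookup cs i)) →
            x ∈ varsST R cs
  varsST⁺ (c ∷ cs) zero p = ∈-++⁺ˡ p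
  varsST⁺ (c ∷ cs) (suc i) p = ∈-++⁺ʳ (vars (proj₁ c) ++ vars (proj₂ c)) (varsST⁺ cs i p)

  lhs⊆Xs : ∀ α j {x} → x ∈ vars (lhs (R α)) → x ∈ Xs R α j
  lhs⊆Xs α j p = ∈-deduplicate⁺ _≟_ (∈-++⁺ˡ p)

  target⊆Xs : ∀ α (i j : Index α) {x} → toℕ i < toℕ j → x ∈ vars (target α i) → x ∈ Xs R α j
  target⊆Xs α i j q p =
    ∈-deduplicate⁺ _≟_ (∈-++⁺ʳ (vars (lhs (R α))) (varsT-take⁺ (conds (R α)) i q p))

  Xs⁻ : ∀ α (j : Index α) {x} → x ∈ Xs R α j →
        x ∈ vars (lhs (R α)) ⊎ Σ (Index α) λ i → toℕ i < toℕ j × x ∈ vars (target α i)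
  Xs⁻ α j p with ∈-++⁻ (vars (lhs (R α))) (∈-deduplicate⁻ _≟_ _ p)
  ... | inj₁ q = inj₁ q
  ... | inj₂ q = inj₂ (varsT-take⁻ (conds (R α)) (toℕ j) q)

  -- Simulation of conditional rewriting by the unraveling

  →R-mono : ∀ {f} → Monotone (_→R_ R) (fun f)
  →R-mono ts i (n , s) = n , arg i s

  arg-mono : ∀ {Rl : RuleSet {Fᵤ R} {arᵤ R}} {f} → Monotone (Step Rl) (fun f)
  arg-mono ts i s = arg i s

  mutual
    Level-suc : ∀ n {l r} → Level R n l r → Level R (suc n) l r
    Level-suc (suc n) (α , σ , p , q , cs) = α , σ , p , q , All.map (Steps-suc n) cs

    Steps-suc : ∀ n {a b} → Steps (Level R n) a b → Steps (Level R (suc n)) a b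
    Steps-suc n ε = ε
    Steps-suc n (s ◅ ss) = Step-suc n s ◅ Steps-suc n ss

    Step-suc : ∀ n {a b} → Step (Level R n) a b → Step (Level R (suc n)) a b
    Step-suc n (root σ h) = root σ (Level-suc n h)
    Step-suc n (arg i s) = arg i (Step-suc n s)

  Step-mono : ∀ {n m a b} → n ≤′ m → Step (Level R n) a b → Step (Level R m) a b
  Step-mono ≤′-refl s = s
  Step-mono (≤′-step p) s = Step-suc _ (Step-mono p s)

  Steps-mono : ∀ {n m a b} → n ≤ m → Steps (Level R n) a b → Steps (Level R m) a b
  Steps-mono p = gmap (λ a → a) (Step-mono (≤⇒≤′ p))

  ↠ᴿ⇒Steps : ∀ {a b} → a ↠ᴿ b → ∃ λ n → Steps (Level R n) a b
  ↠ᴿ⇒Steps ε = 0 , ε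
  ↠ᴿ⇒Steps ((n , s) ◅ ss) with ↠ᴿ⇒Steps ss
  ... | m , ss′ = n ⊔ m , Step-mono (≤⇒≤′ (m≤m⊔n n m)) s ◅ Steps-mono (m≤n⊔m n m) ss′

  common-level : ∀ {σ} (cs : List (T × T)) → All (λ c → (proj₁ c ⟨ σ ⟩) ↠ᴿ (proj₂ c ⟨ σ ⟩)) cs →
                 ∃ λ n → All (λ c → Steps (Level R n) (proj₁ c ⟨ σ ⟩) (proj₂ c ⟨ σ ⟩)) cs
  common-level [] [] = 0 , []
  common-level (c ∷ cs) (p ∷ ps) with ↠ᴿ⇒Steps p | common-level cs ps
  ... | n , q | m , qs =
    n ⊔ m , Steps-mono (m≤m⊔n n m) q ∷ All.map (Steps-mono (m≤n⊔m n m)) qs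

  fire : ∀ α σ → (∀ i → (source α i ⟨ σ ⟩) ↠ᴿ (target α i ⟨ σ ⟩)) →
         _→R_ R (lhs (R α) ⟨ σ ⟩) (rhs (R α) ⟨ σ ⟩)
  fire α σ h with common-level (conds (R α)) (All-fin (conds (R α)) h)
  -- `Level` already consists of rule instances, so the root step carries the identity substitution.
  ... | n , cs = suc n , subst₂ (Step (Level R (suc n))) (subst-id _) (subst-id _)
                           (root var (α , σ , refl , refl , cs))

  -- Induction on the position of `j`, kept as the number `m`: reach the previous U-symbol, rewrite
  -- its first argument from s_i to t_i, apply a middle rule. Only conditions before `j` are used,
  -- so partly solved conditions suffice.
  reach : ∀ α σ m (j : Index α) → toℕ j ≡ m →
          (∀ i → toℕ i < toℕ j → (sᵤ R α i ⟨ σ ⟩) ↠ (tᵤ R α i ⟨ σ ⟩)) →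
          (lhsᵤ α ⟨ σ ⟩) ↠ (Uterm R α j (sᵤ R α j) ⟨ σ ⟩)
  reach α σ zero j e h = return (root σ (start α j e))
  reach α σ (suc m) j e h =
    reach α σ m i i≡m (λ k k<i → h k (≤-trans k<i (<⇒≤ i<j))) ◅◅
    star-arg (Step (Useq R)) {C = fun (inj₂ (α , i))} arg-mono _ zero (h i i<j) ◅◅
    return (root σ (middle α i j (trans (cong suc i≡m) (sym e))))
    where
    m<k : m < length (conds (R α))
    m<k = ≤-trans (≤-reflexive (sym e)) (<⇒≤ (toℕ<n j))
    i : Index α
    i = fromℕ< m<k
    i≡m : toℕ i ≡ m
    i≡m = toℕ-fromℕ< m<k
    i<j : toℕ i < toℕ j
    i<j = ≤-reflexive (trans (cong suc i≡m) (sym e))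

  simulate : ∀ α σ → (∀ i → (sᵤ R α i ⟨ σ ⟩) ↠ (tᵤ R α i ⟨ σ ⟩)) →
             (lhsᵤ α ⟨ σ ⟩) ↠ (ι (rhs (R α)) ⟨ σ ⟩)
  simulate α σ h with []-or-last (conds (R α))
  ... | inj₁ e = return (root σ (uncond α e))
  ... | inj₂ (j , e) =
    reach α σ _ j refl (λ i _ → h i) ◅◅
    star-arg (Step (Useq R)) {C = fun (inj₂ (α , j))} arg-mono _ zero (h j) ◅◅
    return (root σ (finish α j e))

  steps-subst : ∀ {a b} τ → a ↠ b → (a ⟨ τ ⟩) ↠ (b ⟨ τ ⟩)
  steps-subst τ = gmap (_⟨ τ ⟩) (step-subst τ)

  mutual
    -- Induction on the level: the conditions hold one level below, and their embedded derivations
    -- drive the U-symbols from l to r.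
    emb-step : ∀ n {a b} → Step (Level R n) a b → ι a ↠ ι b
    emb-step (suc n) (root τ (α , σ , refl , refl , cs)) =
      subst₂ _↠_ (sym (twice (lhs (R α)))) (sym (twice (rhs (R α))))
        (steps-subst (ι ∘ τ) (simulate α (ι ∘ σ) λ i →
          subst₂ _↠_ (emb-subst (source α i) σ) (emb-subst (target α i) σ)
            (lookup-All (emb-conds n cs) i)))
      where
      -- A root step instantiates a rule of `Level` that is itself an instance, hence two
      -- substitutions.
      twice : ∀ t → ι (t ⟨ σ ⟩ ⟨ τ ⟩) ≡ ι t ⟨ ι ∘ σ ⟩ ⟨ ι ∘ τ ⟩
      twice t = trans (emb-subst (t ⟨ σ ⟩) τ) (cong (_⟨ ι ∘ τ ⟩) (emb-subst t σ))
    emb-step n (arg {f} {ts} i {u} s) =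
      subst (λ us → ι (fun f ts) ↠ fun (inj₁ f) us) (sym (embV-update ts i u))
        (star-arg (Step (Useq R)) {C = fun (inj₁ f)} arg-mono (embV R ts) i
          (subst (_↠ ι u) (sym (lookup-embV ts i)) (emb-step n s)))

    emb-steps-level : ∀ n {a b} → Steps (Level R n) a b → ι a ↠ ι b
    emb-steps-level n ε = ε
    emb-steps-level n (s ◅ ss) = emb-step n s ◅◅ emb-steps-level n ss

    emb-conds : ∀ n {σ cs} → All (λ c → Steps (Level R n) (proj₁ c ⟨ σ ⟩) (proj₂ c ⟨ σ ⟩)) cs →
                All (λ c → ι (proj₁ c ⟨ σ ⟩) ↠ ι (proj₂ c ⟨ σ ⟩)) cs
    emb-conds n [] = []
    emb-conds n (p ∷ ps) = emb-steps-level n p ∷ emb-conds n ps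

  emb-steps : ∀ {a b} → a ↠ᴿ b → ι a ↠ ι b
  emb-steps ε = ε
  emb-steps ((n , s) ◅ ss) = emb-step n s ◅◅ emb-steps ss

  -- Reducts of instances of right-stable targets

  Stable : T → Set
  Stable t = LinearConstructorTerm R t ⊎ (Ground R t × NormalForm (Ru R) t)

  -- Bindings outside `xs` are fixed exactly and not merely up to reduction; this keeps disjoint
  -- arguments, and later l and the earlier conditions, unchanged.
  Refines : List ℕ → (ℕ → Tᵤ) → (ℕ → Tᵤ) → Set
  Refines xs σ τ = (∀ x → σ x ↠ τ x) × (∀ x → x ∉ xs → τ x ≡ σ x)

  module _ (lhs-nonvar : ∀ α x → lhs (R α) ≢ var x) where

    lhs-root : ∀ {α σ f us} → lhsᵤ α ⟨ σ ⟩ ≡ fun (inj₁ f) us → Defined R f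
    lhs-root {α} e with lhs (R α) in eq
    ... | var x = ⊥-elim (lhs-nonvar α x eq)
    lhs-root {α} refl | fun f ts = α , ts , eq

    rule-root : ∀ {l r σ f us} → Useq R l r → l ⟨ σ ⟩ ≡ fun (inj₁ f) us → Defined R f
    rule-root (uncond α _) e = lhs-root {α} e
    rule-root (start α _ _) e = lhs-root {α} e
    rule-root (middle α _ _ _) ()
    rule-root (finish α _ _) ()

    mutual
      -- No redex can start at a constructor of `t`, so the step happens inside some `σ x`; by
      -- linearity `x` occurs once, and rebinding it accounts for the whole step.
      constructor-step : ∀ t {σ a b} → Unique (vars t) → (∀ f → f occursIn t → ¬ Defined R f) →
                         a ≡ ι t ⟨ σ ⟩ → Step (Useq R) a b →
                         ∃ λ τ → b ≡ ι t ⟨ τ ⟩ × Refines (vars t) σ τ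
      constructor-step (var x) {σ} {b = b} u c refl s =
        updateAt-var x b σ , sym (updateAt-var-≡ x) , steps , λ y y∉ → updateAt-var-≢ λ e → y∉ (here (sym e))
        where
        steps : ∀ y → σ y ↠ updateAt-var x b σ y
        steps y with x ≟ y
        ... | yes refl = return s
        ... | no  _ = ε
      constructor-step (fun f ts) u c e (root σ r) = ⊥-elim (c f (here ts) (rule-root r e))
      constructor-step (fun f ts) u c refl (arg i s)
        with constructor-stepV ts i u (λ g o → c g (below o)) s
      ... | τ , e , h = τ , cong (fun (inj₁ f)) e , h

      constructor-stepV : ∀ {n} (ts : Vec T n) i {σ b} → Unique (varsV ts) →
                          (∀ f → f occursInV ts → ¬ Defined R f) →
                          Step (Useq R) (lookup (substs (embV R ts) σ) i) b →
                          ∃ λ τ → (substs (embV R ts) σ [ i ]≔ b) ≡ substs (embV R ts) τ ×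
                                  Refines (varsV ts) σ τ
      constructor-stepV (t ∷ ts) zero u c s
        with constructor-step t (Unique-++ˡ (vars t) u) (λ f o → c f (here o)) refl s
      ... | τ , refl , h , k =
        -- By linearity the variables rebound in the head do not occur in the tail.
        τ , cong (_ ∷_) (substs-cong (embV R ts) λ {x} p →
              sym (k x λ q → Unique-++-disjoint (vars t) u q (subst (x ∈_) (varsV-embV ts) p)))
          , h , λ x x∉ → k x (x∉ ∘ ∈-++⁺ˡ)
      constructor-stepV (t ∷ ts) (suc i) u c s
        with constructor-stepV ts i (Unique-++ʳ (vars t) u) (λ f o → c f (there o)) s
      ... | τ , e , h , k =
        τ , cong₂ _∷_ (emb-subst-cong t λ {x} p →
              sym (k x (Unique-++-disjoint (vars t) u p))) e
          , h , λ x x∉ → k x (x∉ ∘ ∈-++⁺ʳ (vars t))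

  mutual
    -- A ground `t` contributes no U-symbols, so the redex is an instance of an embedded left-hand
    -- side; decoding its matching substitution gives a redex of the underlying system. Irreducible
    -- ground targets therefore admit no step in the unraveling.
    ground-step : ∀ t {σ a b} → vars t ≡ [] → a ≡ ι t ⟨ σ ⟩ → Step (Useq R) a b →
                  ∃ (Step (Ru R) t)
    ground-step (var x) () e s
    ground-step t@(fun f ts) {σ} g e (root τ r) = ground-root r e
      where
      at-lhs : ∀ α → lhsᵤ α ⟨ τ ⟩ ≡ ι t ⟨ σ ⟩ → ∃ (Step (Ru R) t)
      at-lhs α e = rhs (R α) ⟨ decode ∘ τ ⟩ , subst (λ z → Step (Ru R) z (rhs (R α) ⟨ decode ∘ τ ⟩))
        (trans (sym (decode-emb-subst (lhs (R α)) τ))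
          (trans (cong decode e) (trans (decode-emb-subst t σ) (ground-subst t g))))
        (root (decode ∘ τ) (α , refl , refl))
      ground-root : ∀ {l r} → Useq R l r → l ⟨ τ ⟩ ≡ ι t ⟨ σ ⟩ → ∃ (Step (Ru R) t)
      ground-root (uncond α _) e = at-lhs α e
      ground-root (start α _ _) e = at-lhs α e
      ground-root (middle α _ _ _) ()
      ground-root (finish α _ _) ()
    ground-step (fun f ts) g refl (arg i s) with ground-stepV ts i g s
    ... | u , s′ = fun f (ts [ i ]≔ u) , arg i s′

    ground-stepV : ∀ {n} (ts : Vec T n) i {σ b} → varsV ts ≡ [] →
                   Step (Useq R) (lookup (substs (embV R ts) σ) i) b →
                   ∃ (Step (Ru R) (lookup ts i))
    ground-stepV (t ∷ ts) zero g s = ground-step t (++-conicalˡ (vars t) _ g) refl s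
    ground-stepV (t ∷ ts) (suc i) g s = ground-stepV ts i (++-conicalʳ (vars t) _ g) s

  module _ (lhs-nonvar : ∀ α x → lhs (R α) ≢ var x) where

    stable-step : ∀ t {σ b} → Stable t → Step (Useq R) (ι t ⟨ σ ⟩) b →
                  ∃ λ τ → b ≡ ι t ⟨ τ ⟩ × Refines (vars t) σ τ
    stable-step t (inj₁ (u , c)) s = constructor-step lhs-nonvar t u c refl s
    stable-step t (inj₂ (g , nf)) s with ground-step t g refl s
    ... | u , s′ = ⊥-elim (nf u s′)

    stable-steps : ∀ t {σ b} → Stable t → (ι t ⟨ σ ⟩) ↠ b →
                   ∃ λ τ → b ≡ ι t ⟨ τ ⟩ × Refines (vars t) σ τ
    stable-steps t {σ} st ss = go ss refl
      where
      go : ∀ {σ a b} → a ↠ b → a ≡ ι t ⟨ σ ⟩ → ∃ λ τ → b ≡ ι t ⟨ τ ⟩ × Refines (vars t) σ τ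
      go {σ} ε e = σ , e , (λ _ → ε) , λ _ _ → refl
      go (s ◅ ss) refl with stable-step t st s
      ... | τ , refl , h , k with go ss refl
      ...   | ρ , e , h′ , k′ = ρ , e , (λ x → h x ◅◅ h′ x) , λ x x∉ → trans (k′ x x∉) (k x x∉)

  lhs-rewritable : ∀ α → ∃ (Useq R (lhsᵤ α))
  lhs-rewritable α with []-or-first (conds (R α))
  ... | inj₁ e = _ , uncond α e
  ... | inj₂ (j , e) = _ , start α j e

  -- A variable left-hand side would match every term.
  terminating⇒lhs-nonvar : Terminating (Step (Useq R)) → ∀ α x → lhs (R α) ≢ var x
  terminating⇒lhs-nonvar term α x e = go (term (var x))
    where
    go : ∀ {a} → Acc (flip (Step (Useq R))) a → ⊥
    go {a} (acc rs) with lhs-rewritable α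
    ... | r , h = go (rs (subst (λ l → Step (Useq R) (ι l ⟨ (λ _ → a) ⟩) (r ⟨ (λ _ → a) ⟩)) e (root (λ _ → a) h)))

  -- The joinability invariant and its preservation

  module _ (det : DCTRS R) (stable : RightStable R)
           (confluent : Confluent (Step (Useq R))) (terminating : Terminating (Step (Useq R))) where

    _⇓_ : Tᵤ → Tᵤ → Set
    _⇓_ = Joinable (Step (Useq R))

    -- Confluence is applied twice, once for each side being reduced.
    ⇓-reduce : ∀ {a b a′ b′} → a ⇓ b → a ↠ a′ → b ↠ b′ → a′ ⇓ b′
    ⇓-reduce (c , p , q) r s with confluent p r
    ... | d , d₁ , d₂ with confluent (q ◅◅ d₁) s
    ...   | e , e₁ , e₂ = e , d₂ ◅◅ e₁ , e₂

    ↠-subst : ∀ t {σ τ : ℕ → Tᵤ} → (∀ x → σ x ↠ τ x) → (t ⟨ σ ⟩) ↠ (t ⟨ τ ⟩)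
    ↠-subst t h = star-subst (Step (Useq R)) arg-mono t (λ {x} _ → h x)

    source⊆Xs : ∀ α (i j : Index α) {x} → toℕ i ≤ toℕ j → x ∈ vars (source α i) → x ∈ Xs R α j
    source⊆Xs α i j i≤j p with ∈-++⁻ (vars (lhs (R α))) (proj₂ (det α) i p)
    ... | inj₁ q = lhs⊆Xs α j q
    ... | inj₂ q with varsT-take⁻ (conds (R α)) (toℕ i) q
    ...   | k , k<i , r = target⊆Xs α k j (≤-trans k<i i≤j) r

    -- Determinism puts the variables of every source into l and the earlier targets, so only the
    -- last target may contribute variables not stored under the last U-symbol.
    rule-vars-last : ∀ α (j : Index α) {x} → suc (toℕ j) ≡ length (conds (R α)) →
                     x ∈ vars (lhs (R α)) ++ varsST R (conds (R α)) →
                     x ∈ Xs R α j ⊎ x ∈ vars (target α j)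
    rule-vars-last α j e p with ∈-++⁻ (vars (lhs (R α))) p
    ... | inj₁ q = inj₁ (lhs⊆Xs α j q)
    ... | inj₂ q with varsST⁻ (conds (R α)) q
    ...   | i , r with m<1+n⇒m<n∨m≡n (subst (toℕ i <_) (sym e) (toℕ<n i)) | ∈-++⁻ (vars (source α i)) r
    ...     | inj₁ i<j | inj₁ r′ = inj₁ (source⊆Xs α i j (<⇒≤ i<j) r′)
    ...     | inj₁ i<j | inj₂ r′ = inj₁ (target⊆Xs α i j i<j r′)
    ...     | inj₂ i≡j | inj₁ r′ = inj₁ (source⊆Xs α i j (≤-reflexive i≡j) r′)
    ...     | inj₂ i≡j | inj₂ r′ with toℕ-injective i≡j
    ...       | refl = inj₂ r′

    Held : ∀ α → Index α → (ℕ → Tᵤ) → Set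
    Held α j σ = ∀ i → toℕ i < toℕ j → (sᵤ R α i ⟨ σ ⟩) ⇓ (tᵤ R α i ⟨ σ ⟩)

    -- Joinability, unlike reachability, survives rewriting the stored bindings us.
    mutual
      Good : Tᵤ → Set
      Good (var x) = ⊤
      Good (fun (inj₁ f) us) = GoodV us
      Good (fun (inj₂ (α , j)) (b ∷ us)) =
        Good b × GoodV us × Held α j (env (Xs R α j) us) × (sᵤ R α j ⟨ env (Xs R α j) us ⟩) ⇓ b

      GoodV : ∀ {n} → Vec Tᵤ n → Set
      GoodV [] = ⊤
      GoodV (u ∷ us) = Good u × GoodV us

    goodV-lookup : ∀ {n} (us : Vec Tᵤ n) i → GoodV us → Good (lookup us i)
    goodV-lookup (u ∷ us) zero (g , _) = g
    goodV-lookup (u ∷ us) (suc i) (_ , gs) = goodV-lookup us i gs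

    goodV-update : ∀ {n} (us : Vec Tᵤ n) i {v} → GoodV us → Good v → GoodV (us [ i ]≔ v)
    goodV-update (u ∷ us) zero (_ , gs) g = g , gs
    goodV-update (u ∷ us) (suc i) (g , gs) h = g , goodV-update us i gs h

    good-env : ∀ xs us → GoodV us → ∀ x → Good (env xs us x)
    good-env [] [] _ x = tt
    good-env (y ∷ ys) (u ∷ us) (g , gs) x with x ≟ y
    ... | yes _ = g
    ... | no  _ = good-env ys us gs x

    mutual
      good-emb : ∀ t → Good (ι t)
      good-emb (var x) = tt
      good-emb (fun f ts) = goodV-embV ts

      goodV-embV : ∀ {n} (ts : Vec T n) → GoodV (embV R ts)
      goodV-embV [] = tt
      goodV-embV (t ∷ ts) = good-emb t , goodV-embV ts

    mutual
      good-instance⁺ : ∀ t {σ} → (∀ {x} → x ∈ vars t → Good (σ x)) → Good (ι t ⟨ σ ⟩)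
      good-instance⁺ (var x) h = h (here refl)
      good-instance⁺ (fun f ts) h = goodV-instance⁺ ts h

      goodV-instance⁺ : ∀ {n} (ts : Vec T n) {σ} → (∀ {x} → x ∈ varsV ts → Good (σ x)) →
                        GoodV (substs (embV R ts) σ)
      goodV-instance⁺ [] h = tt
      goodV-instance⁺ (t ∷ ts) h =
        good-instance⁺ t (h ∘ ∈-++⁺ˡ) , goodV-instance⁺ ts (h ∘ ∈-++⁺ʳ (vars t))

    mutual
      good-instance⁻ : ∀ t {σ x} → Good (ι t ⟨ σ ⟩) → x ∈ vars t → Good (σ x)
      good-instance⁻ (var x) g (here refl) = g
      good-instance⁻ (fun f ts) g p = goodV-instance⁻ ts g p

      goodV-instance⁻ : ∀ {n} (ts : Vec T n) {σ x} → GoodV (substs (embV R ts) σ) →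
                        x ∈ varsV ts → Good (σ x)
      goodV-instance⁻ (t ∷ ts) (g , gs) p with ∈-++⁻ (vars t) p
      ... | inj₁ q = good-instance⁻ t g q
      ... | inj₂ q = goodV-instance⁻ ts gs q

    goodV-vars : ∀ xs {σ} → (∀ {x} → x ∈ xs → Good (σ x)) →
                 GoodV (substs (Vec.map var (fromList xs)) σ)
    goodV-vars [] h = tt
    goodV-vars (x ∷ xs) h = h (here refl) , goodV-vars xs (h ∘ there)

    module _ (α : I) (j : Index α) (σ : ℕ → Tᵤ) where

      private
        -- What `env` reads back from the arguments of an instantiated U-term: it equals `σ` on
        -- `Xs R α j` and is the identity elsewhere.
        stored : ℕ → Tᵤ
        stored = env (Xs R α j) (substs (Vec.map var (fromList (Xs R α j))) σ)

      source-stored : ∀ i → toℕ i ≤ toℕ j → sᵤ R α i ⟨ stored ⟩ ≡ sᵤ R α i ⟨ σ ⟩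
      source-stored i i≤j = emb-subst-cong (source α i) λ p →
        env-vars (Xs R α j) σ (source⊆Xs α i j i≤j p)

      target-stored : ∀ i → toℕ i < toℕ j → tᵤ R α i ⟨ stored ⟩ ≡ tᵤ R α i ⟨ σ ⟩
      target-stored i i<j = emb-subst-cong (target α i) λ p →
        env-vars (Xs R α j) σ (target⊆Xs α i j i<j p)

      decode-Uterm : ∀ b → decode (Uterm R α j b ⟨ σ ⟩) ≡ lhs (R α) ⟨ decode ∘ σ ⟩
      decode-Uterm b = trans (decode-U α j (b ⟨ σ ⟩) _)
        (subst-cong (lhs (R α)) λ p → cong decode (env-vars (Xs R α j) σ (lhs⊆Xs α j p)))

      good-Uterm⁺ : ∀ b → Good (b ⟨ σ ⟩) → (∀ {x} → x ∈ Xs R α j → Good (σ x)) → Held α j σ →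
                    (sᵤ R α j ⟨ σ ⟩) ⇓ (b ⟨ σ ⟩) → Good (Uterm R α j b ⟨ σ ⟩)
      good-Uterm⁺ b g gs h k =
        g , goodV-vars (Xs R α j) gs
          , (λ i i<j → subst₂ _⇓_ (sym (source-stored i (<⇒≤ i<j))) (sym (target-stored i i<j)) (h i i<j))
          , subst (_⇓ _) (sym (source-stored j ≤-refl)) k

      good-Uterm⁻ : ∀ b → Good (Uterm R α j b ⟨ σ ⟩) →
                    Good (b ⟨ σ ⟩) × (∀ {x} → x ∈ Xs R α j → Good (σ x)) × Held α j σ ×
                    (sᵤ R α j ⟨ σ ⟩) ⇓ (b ⟨ σ ⟩)
      good-Uterm⁻ b (g , gs , h , k) =
        g , (λ {x} p → subst Good (env-vars (Xs R α j) σ p) (good-env (Xs R α j) _ gs x))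
          , (λ i i<j → subst₂ _⇓_ (source-stored i (<⇒≤ i<j)) (target-stored i i<j) (h i i<j))
          , subst (_⇓ _) (source-stored j ≤-refl) k

    extend-Held : ∀ α {j k : Index α} {σ} → toℕ k ≡ suc (toℕ j) → Held α j σ →
                  (sᵤ R α j ⟨ σ ⟩) ⇓ (tᵤ R α j ⟨ σ ⟩) → Held α k σ
    extend-Held α e h p i i<k with m<1+n⇒m<n∨m≡n (subst (toℕ i <_) e i<k)
    ... | inj₁ i<j = h i i<j
    ... | inj₂ i≡j with toℕ-injective i≡j
    ...   | refl = p

    -- Variables of the last target inherit goodness from the body t_kσ, all others from the stored
    -- bindings.
    good-last : ∀ α (j : Index α) {σ x} → suc (toℕ j) ≡ length (conds (R α)) →
                Good (Uterm R α j (tᵤ R α j) ⟨ σ ⟩) →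
                x ∈ vars (lhs (R α)) ++ varsST R (conds (R α)) → Good (σ x)
    good-last α j {σ} e g p with good-Uterm⁻ α j σ (tᵤ R α j) g | rule-vars-last α j e p
    ... | gb , gs , _ | inj₁ q = gs q
    ... | gb , gs , _ | inj₂ q = good-instance⁻ (target α j) gb q

    -- Start and middle rules create a body s_iσ, joinable with itself; a middle rule moreover turns
    -- the joinability of s_jσ with the body t_jσ into a held condition. Steps below a U-symbol
    -- preserve joinability by confluence.
    good-step : ∀ {u v} → Good u → Step (Useq R) u v → Good v
    good-step g (root σ (uncond α e)) = good-instance⁺ (rhs (R α)) λ {x} p →
      good-instance⁻ (lhs (R α)) g (no-conds x (proj₁ (det α) p))
      where
      no-conds : ∀ x → x ∈ vars (lhs (R α)) ++ varsST R (conds (R α)) → x ∈ vars (lhs (R α))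
      no-conds x p with ∈-++⁻ (vars (lhs (R α))) p
      ... | inj₁ q = q
      ... | inj₂ q with subst (λ cs → x ∈ varsST R cs) e q
      ...   | ()
    good-step g (root σ (start α j j≡0)) =
      good-Uterm⁺ α j σ (sᵤ R α j) (good-instance⁺ (source α j) (from-lhs ∘ source⊆Xs α j j ≤-refl)) from-lhs
        (λ i i<j → ⊥-elim (n≮0 (subst (toℕ i <_) j≡0 i<j))) (_ , ε , ε)
      where
      from-lhs : ∀ {x} → x ∈ Xs R α j → Good (σ x)
      from-lhs p with Xs⁻ α j p
      ... | inj₁ q = good-instance⁻ (lhs (R α)) g q
      ... | inj₂ (i , i<j , _) = ⊥-elim (n≮0 (subst (toℕ i <_) j≡0 i<j))
    good-step g (root σ (middle α j k e)) with good-Uterm⁻ α j σ (tᵤ R α j) g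
    ... | gb , gs , h , p =
      good-Uterm⁺ α k σ (sᵤ R α k) (good-instance⁺ (source α k) (next ∘ source⊆Xs α k k ≤-refl)) next
        (extend-Held α (sym e) h p) (_ , ε , ε)
      where
      next : ∀ {x} → x ∈ Xs R α k → Good (σ x)
      next p with Xs⁻ α k p
      ... | inj₁ q = gs (lhs⊆Xs α j q)
      ... | inj₂ (i , i<k , q) with m<1+n⇒m<n∨m≡n (subst (toℕ i <_) (sym e) i<k)
      ...   | inj₁ i<j = gs (target⊆Xs α i j i<j q)
      ...   | inj₂ i≡j with toℕ-injective i≡j
      ...     | refl = good-instance⁻ (target α j) gb q
    good-step g (root σ (finish α j e)) =
      good-instance⁺ (rhs (R α)) (good-last α j e g ∘ proj₁ (det α))
    good-step g (arg {inj₁ f} {ts} i s) = goodV-update ts i g (good-step (goodV-lookup ts i g) s)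
    good-step (g , gs , h , k) (arg {inj₂ (α , j)} {b ∷ us} zero s) =
      good-step g s , gs , h , ⇓-reduce k ε (return s)
    good-step (g , gs , h , k) (arg {inj₂ (α , j)} {b ∷ us} (suc p) s) =
      g , goodV-update us p gs (good-step (goodV-lookup us p gs) s)
        , (λ i i<j → ⇓-reduce (h i i<j) (↠-subst (sᵤ R α i) reduced) (↠-subst (tᵤ R α i) reduced))
        , ⇓-reduce k (↠-subst (sᵤ R α j) reduced) ε
      where
      reduced : ∀ x → env (Xs R α j) us x ↠ env (Xs R α j) (us [ p ]≔ _) x
      reduced = env-update-rel _↠_ ε (Xs R α j) us p (return s)

    good-steps : ∀ {u v} → Good u → u ↠ v → Good v
    good-steps g ε = g
    good-steps g (s ◅ ss) = good-steps (good-step g s) ss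

    -- Simulation of the unraveling by conditional rewriting

    Simulates : Tᵤ → Set
    Simulates u = ∀ {v} → u ↠ v → ∃ λ v′ → v ↠ v′ × decode u ↠ᴿ decode v′

    _⊒_ : Tᵤ → Tᵤ → Set
    _⊒_ = Star (_≻_ {Rl = Useq R})

    ↠⇒⊒ : ∀ {a b} → a ↠ b → a ⊒ b
    ↠⇒⊒ = gmap (λ a → a) inj₁

    -- Induction hypothesis for a fixed bound `m`. The bound concerns `ι (decode u)` and not `u`: a
    -- pending term counts as lσ, the term from which the sources of its conditions are reached.
    SimulatesBelow : Tᵤ → Set
    SimulatesBelow m = ∀ {m′} → _≻_ {Rl = Useq R} m m′ → ∀ {u} → Good u → m′ ⊒ ι (decode u) → Simulates u

    lhs-nonvar : ∀ α x → lhs (R α) ≢ var x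
    lhs-nonvar = terminating⇒lhs-nonvar terminating

    -- Satisfies the conditions from left to right: by right-stability a common reduct of both sides
    -- of condition j only rebinds variables of t_j, which occur neither in l nor in earlier conditions.
    solve : ∀ {m} → SimulatesBelow m → ∀ α σ → m ⊒ ι (lhs (R α) ⟨ decode ∘ σ ⟩) →
            (∀ {x} → x ∈ vars (lhs (R α)) ++ varsST R (conds (R α)) → Good (σ x)) →
            (∀ i → (sᵤ R α i ⟨ σ ⟩) ⇓ (tᵤ R α i ⟨ σ ⟩)) →
            ∀ n → n ≤ length (conds (R α)) →
            ∃ λ τ → (∀ x → σ x ↠ τ x) × (∀ {x} → x ∈ vars (lhs (R α)) → τ x ≡ σ x) ×
                    (∀ i → toℕ i < n → (source α i ⟨ decode ∘ τ ⟩) ↠ᴿ (target α i ⟨ decode ∘ τ ⟩))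
    solve ih α σ m⊒l good joins zero _ = σ , (λ _ → ε) , (λ _ → refl) , λ _ ()
    solve ih α σ m⊒l good joins (suc n) n<k with solve ih α σ m⊒l good joins n (<⇒≤ n<k)
    ... | τ , σ↠τ , τ≡σ , sat = result
      where
      j : Index α
      j = fromℕ< n<k
      j≡n : toℕ j ≡ n
      j≡n = toℕ-fromℕ< n<k

      join : (sᵤ R α j ⟨ τ ⟩) ⇓ (tᵤ R α j ⟨ τ ⟩)
      join = ⇓-reduce (joins j) (↠-subst (sᵤ R α j) σ↠τ) (↠-subst (tᵤ R α j) σ↠τ)

      emb-decode : ∀ t → ι t ⟨ ι ∘ decode ∘ τ ⟩ ≡ ι (t ⟨ decode ∘ τ ⟩)
      emb-decode t = sym (emb-subst t (decode ∘ τ))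

      -- The conditions solved so far, embedded in the unraveling, drive the decoded lσ to the
      -- U-term whose first argument is the decoded instance of s_j; `τ` agrees with `σ` on l.
      lhs-reaches : ι (lhs (R α) ⟨ decode ∘ σ ⟩) ↠ (Uterm R α j (sᵤ R α j) ⟨ ι ∘ decode ∘ τ ⟩)
      lhs-reaches = subst (_↠ (Uterm R α j (sᵤ R α j) ⟨ ι ∘ decode ∘ τ ⟩))
        (trans (emb-decode (lhs (R α))) (cong ι (subst-cong (lhs (R α)) (cong decode ∘ τ≡σ))))
        (reach α _ (toℕ j) j refl λ i i<j →
          subst₂ _↠_ (sym (emb-decode (source α i))) (sym (emb-decode (target α i)))
            (emb-steps (sat i (subst (toℕ i <_) j≡n i<j))))

      simulates : Simulates (sᵤ R α j ⟨ τ ⟩)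
      -- The final descent from the U-term to its first argument guarantees a strict step below `m`,
      -- as the induction hypothesis demands.
      simulates with Star-snoc⇒cons (m⊒l ◅◅ ↠⇒⊒ lhs-reaches) (inj₂ (sub zero))
      ... | m′ , m≻m′ , m′⊒ = ih m≻m′
        (good-instance⁺ (source α j) λ {x} p →
          good-steps (good (∈-++⁺ʳ (vars (lhs (R α))) (varsST⁺ (conds (R α)) j (∈-++⁺ˡ p)))) (σ↠τ x))
        (subst (m′ ⊒_) (trans (emb-decode (source α j)) (cong ι (sym (decode-emb-subst (source α j) τ))))
          m′⊒)

      Result : Set
      Result = ∃ λ ρ → (∀ x → σ x ↠ ρ x) × (∀ {x} → x ∈ vars (lhs (R α)) → ρ x ≡ σ x) ×
        (∀ i → toℕ i < suc n → (source α i ⟨ decode ∘ ρ ⟩) ↠ᴿ (target α i ⟨ decode ∘ ρ ⟩))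

      result : Result
      result with join
      ... | c , p , q with simulates p
      -- The simulation of `p` may overshoot `c`, but `e` is still a reduct of t_jτ, hence of the
      -- form t_jρ by right-stability.
      ...   | e , c↠e , d with stable-steps lhs-nonvar (target α j) (proj₁ (stable α j)) (q ◅◅ c↠e)
      ...     | ρ , refl , τ↠ρ , ρ≡τ =
        ρ , (λ x → σ↠τ x ◅◅ τ↠ρ x) , (λ p → trans (unchanged (∈-++⁺ˡ p)) (τ≡σ p)) , sat′
        where
        unchanged : ∀ {x} → x ∈ vars (lhs (R α)) ++ varsST R (take (toℕ j) (conds (R α))) ++ vars (source α j) →
                    ρ x ≡ τ x
        unchanged p = ρ≡τ _ λ q → proj₂ (stable α j) q p

        earlier : ∀ i {x} → toℕ i < toℕ j → x ∈ vars (source α i) ++ vars (target α i) → ρ x ≡ τ x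
        earlier i i<j p = unchanged (∈-++⁺ʳ (vars (lhs (R α))) (∈-++⁺ˡ (varsST-take⁺ (conds (R α)) i i<j p)))

        sat′ : ∀ i → toℕ i < suc n → (source α i ⟨ decode ∘ ρ ⟩) ↠ᴿ (target α i ⟨ decode ∘ ρ ⟩)
        sat′ i i<1+n with m<1+n⇒m<n∨m≡n i<1+n
        ... | inj₁ i<n = subst₂ _↠ᴿ_
          (subst-cong (source α i) λ p → cong decode (sym (earlier i i<j (∈-++⁺ˡ p))))
          (subst-cong (target α i) λ p → cong decode (sym (earlier i i<j (∈-++⁺ʳ (vars (source α i)) p))))
          (sat i i<n)
          where
          i<j : toℕ i < toℕ j
          i<j = subst (toℕ i <_) (sym j≡n) i<n
        ... | inj₂ i≡n with toℕ-injective {i = i} {j = j} (trans i≡n (sym j≡n))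
        ...   | refl = subst₂ _↠ᴿ_
          (trans (decode-emb-subst (source α j) τ)
            (subst-cong (source α j) λ p → cong decode (sym (unchanged
              (∈-++⁺ʳ (vars (lhs (R α))) (∈-++⁺ʳ (varsST R (take (toℕ j) (conds (R α)))) p))))))
          (decode-emb-subst (target α j) ρ) d

    -- Start and middle rules leave the decoding unchanged. Unconditional and finish rules give a
    -- conditional step at the root, the latter with the bindings found by `solve`, which causes the
    -- overshoot.
    simulate-step : ∀ {m} → SimulatesBelow m → ∀ {u v} → Good u → m ⊒ ι (decode u) →
                    Step (Useq R) u v → ∃ λ v′ → v ↠ v′ × decode u ↠ᴿ decode v′
    simulate-step ih g m⊒u (root σ (uncond α e)) =
      _ , ε , subst₂ _↠ᴿ_ (sym (decode-emb-subst (lhs (R α)) σ)) (sym (decode-emb-subst (rhs (R α)) σ))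
        (return (fire α (decode ∘ σ) λ i → ⊥-elim (no-index (subst (λ cs → Fin (length cs)) e i))))
      where
      no-index : ¬ Fin 0
      no-index ()
    simulate-step ih g m⊒u (root σ (start α j _)) =
      _ , ε , ≡⇒Star (trans (decode-emb-subst (lhs (R α)) σ) (sym (decode-Uterm α j σ (sᵤ R α j))))
    simulate-step ih g m⊒u (root σ (middle α j k _)) =
      _ , ε , ≡⇒Star (trans (decode-Uterm α j σ (tᵤ R α j)) (sym (decode-Uterm α k σ (sᵤ R α k))))
    simulate-step {m} ih g m⊒u (root σ (finish α j e)) with good-Uterm⁻ α j σ (tᵤ R α j) g
    ... | _ , _ , h , k
      with solve ih α σ (subst (λ t → m ⊒ ι t) (decode-Uterm α j σ (tᵤ R α j)) m⊒u) (good-last α j e g)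
             joins (length (conds (R α))) ≤-refl
      where
      joins : ∀ i → (sᵤ R α i ⟨ σ ⟩) ⇓ (tᵤ R α i ⟨ σ ⟩)
      joins i with m<1+n⇒m<n∨m≡n (subst (toℕ i <_) (sym e) (toℕ<n i))
      ... | inj₁ i<j = h i i<j
      ... | inj₂ i≡j with toℕ-injective i≡j
      ...   | refl = k
    -- The right-hand side is reduced to match the new bindings; the decoded left-hand side is
    -- unaffected because `τ` fixes its variables.
    ... | τ , σ↠τ , τ≡σ , sat =
      _ , ↠-subst (ι (rhs (R α))) σ↠τ ,
      subst₂ _↠ᴿ_
        (sym (trans (decode-Uterm α j σ (tᵤ R α j)) (subst-cong (lhs (R α)) (cong decode ∘ sym ∘ τ≡σ))))
        (sym (decode-emb-subst (rhs (R α)) τ))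
        (return (fire α (decode ∘ τ) λ i → sat i (toℕ<n i)))
    simulate-step {m} ih g m⊒u (arg {inj₁ f} {us} i s)
      with simulate-step ih (goodV-lookup us i g) m⊒uᵢ s
      where
      m⊒uᵢ : m ⊒ ι (decode (lookup us i))
      m⊒uᵢ = m⊒u ◅◅ return (inj₂ (subst (_ ▷_)
        (trans (lookup-embV (decodeV us) i) (cong ι (lookup-decodeV us i))) (sub i)))
    ... | v , u↠v , d =
      fun (inj₁ f) (us [ i ]≔ v) ,
      subst (λ vs → _ ↠ fun (inj₁ f) vs) ([]≔-idempotent us i)
        (star-arg (Step (Useq R)) {C = fun (inj₁ f)} arg-mono (us [ i ]≔ _) i
          (subst (_↠ v) (sym (lookup∘update i us _)) u↠v)) ,
      subst (λ vs → _ ↠ᴿ fun f vs) (sym (decodeV-update us i v))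
        (star-arg (_→R_ R) →R-mono (decodeV us) i (subst (_↠ᴿ decode v) (sym (lookup-decodeV us i)) d))
    -- Decoding ignores the body of a pending term.
    simulate-step ih g m⊒u (arg {inj₂ (α , j)} {b ∷ us} zero s) = _ , ε , ε
    simulate-step {m} ih (_ , gs , _) m⊒u (arg {inj₂ (α , j)} {b ∷ us} (suc p) {u} s)
      with List.lookup (Xs R α j) p ∈? vars (lhs (R α))
    -- A stored variable that comes only from earlier targets is invisible to decoding.
    ... | no ∉lhs = _ , ε , ≡⇒Star (trans (decode-U α j b us)
            (trans (subst-cong (lhs (R α)) λ {x} x∈ → cong decode (sym
                     (env-update-≢ (Xs R α j) us p λ e → ∉lhs (subst (_∈ vars (lhs (R α))) e x∈))))
              (sym (decode-U α j b (us [ p ]≔ u)))))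
    -- The decoded binding is a subterm of the decoded instance of l, hence below `m`; its reduction
    -- is replayed at every occurrence of the variable.
    ... | yes ∈lhs with simulate-step ih (goodV-lookup us p gs) m⊒uₚ s
      where
      m⊒uₚ : m ⊒ ι (decode (lookup us p))
      m⊒uₚ = subst (m ⊒_)
        (cong (ι ∘ decode) (env-lookup (Xs R α j) us p (deduplicate-! _)))
        (subst (λ t → m ⊒ t)
          (trans (cong ι (decode-U α j b us)) (emb-subst (lhs (R α)) (decode ∘ env (Xs R α j) us))) m⊒u
         ◅◅ var-subterm inj₂ (lhsᵤ α) (∈vars-emb⁺ (lhs (R α)) ∈lhs))
    ...   | v , u↠v , d =
      fun (inj₂ (α , j)) (b ∷ us [ p ]≔ v) ,
      subst (λ vs → _ ↠ fun (inj₂ (α , j)) (b ∷ vs)) ([]≔-idempotent us p)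
        (star-arg (Step (Useq R)) {C = fun (inj₂ (α , j))} arg-mono (b ∷ us [ p ]≔ u) (suc p)
          (subst (_↠ v) (sym (lookup∘update p us u)) u↠v)) ,
      subst₂ _↠ᴿ_ (sym (decode-U α j b us)) (sym (decode-U α j b (us [ p ]≔ v)))
        (star-subst (_→R_ R) →R-mono (lhs (R α)) λ {x} _ →
          env-update-rel (λ a b → decode a ↠ᴿ decode b) ε (Xs R α j) us p d x)

    -- The overshoot `t` diverges from the rest `ss`, and confluence supplies a continuation.
    -- Recursion is on an ancestor `a` of `u`, since `s` is followed by the possibly long `t` while
    -- accessibility peels off one step. The bound `m` persists because conditional reductions embed
    -- into the unraveling.
    simulate-steps : ∀ {m} → SimulatesBelow m → ∀ {a} → Acc (flip (Step (Useq R))) a →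
                     ∀ {u} → a ↠ u → Good u → m ⊒ ι (decode u) → Simulates u
    simulate-steps ih h p g q ε = _ , ε , ε
    simulate-steps ih (acc rs) p g q (s ◅ ss) with simulate-step ih g q s
    ... | v , t , d with confluent ss t | Star-snoc⇒cons p s
    ...   | c , c₁ , c₂ | a′ , s′ , p′
      with simulate-steps ih (rs s′) (p′ ◅◅ t) (good-steps g (s ◅ t)) (q ◅◅ ↠⇒⊒ (emb-steps d)) c₂
    ...     | v′ , c↠v′ , d′ = v′ , c₁ ◅◅ c↠v′ , d ◅◅ d′

    -- The bound decreases only inside `solve`; for a fixed bound, termination of the unraveling
    -- suffices.
    simulates-below : ∀ {m} → Acc (flip (_≻_ {Rl = Useq R})) m → ∀ {u} → Good u → m ⊒ ι (decode u) → Simulates u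
    simulates-below (acc rs) g q = simulate-steps (λ m≻m′ → simulates-below (rs m≻m′)) (terminating _) ε g q

    simulates-good : ∀ {u} → Good u → Simulates u
    simulates-good g = simulates-below (≻-wellFounded terminating _) g ε

    -- Simulating u ↠ v overshoots to some v′ below v; swapping roles and simulating v ↠ v′
    -- continues until one side stops moving.
    ↠⇒decode-joinable : ∀ {a u v} → Acc (flip (Step (Useq R))) a → a ↠ v → Good u → u ↠ v →
                        Joinable (_→R_ R) (decode u) (decode v)
    ↠⇒decode-joinable h q g p with simulates-good g p
    ... | v , ε , d = _ , d , ε
    ↠⇒decode-joinable (acc rs) q g p | v′ , s ◅ ss , d with Star-snoc⇒cons q s
    ... | a′ , s′ , q′ with ↠⇒decode-joinable (rs s′) (q′ ◅◅ ss) (good-steps g p) (s ◅ ss)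
    ...   | c , c₁ , c₂ = c , d ◅◅ c₂ , c₁

    →R-confluent : Confluent (_→R_ R)
    →R-confluent {t₁ = t₁} {t₂} p q with confluent (emb-steps p) (emb-steps q)
    ... | w , p′ , q′ with simulates-good (good-emb t₁) p′
    -- Overshooting `w` is harmless: the embedding of `t₂` reaches `v` as well, so it remains to
    -- join `t₂` with the decoding of `v`.
    ...   | v , w↠v , d with ↠⇒decode-joinable (terminating v) ε (good-emb t₂) (q′ ◅◅ w↠v)
    ...     | c , c₁ , c₂ =
      c , subst (_↠ᴿ c) (decode-emb t₁) (d ◅◅ c₂) , subst (_↠ᴿ c) (decode-emb t₂) c₁

theorem22 : {F : Set} {ar : F → ℕ} {I : Set} (R : I → CRule F ar) →
    DCTRS R → RightStable R →
    Confluent (Step (Useq R)) → Terminating (Step (Useq R)) →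
    Confluent (_→R_ R)
theorem22 R = Unraveling.→R-confluent R
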